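{- Let $G$, $\{f_v\}_{v\in V}$, $S$, $T$ be an instance of the cLPI problem and let a Threshold Blocking (TB) oracle be given. If $\mathbf{x}$ is an output of the Full Set Interdiction algorithm and $\mathbf{x}^*$ is an optimal solution to the cLPI instance, then $$\|\mathbf{x}\|\le \|\mathbf{x}^*\|\cdot O\big(\ln(|\mathcal{F}|\,\varepsilon^{ -1})\big).$$
   Context: cLPI instance: a directed graph $G=(V,E)$; for each $v\in V$ a monotone non-decreasing function $f_v:\mathbb{R}_{\ge0}\to\mathbb{R}_{\ge0}$; a set $S$ of target pairs of nodes; a threshold $T$. Impact vectors are nonnegative vectors indexed by $V$, with $\|\mathbf{x}\|=\sum_v x_v$. For a path $p$ (identified with its sequence of nodes), $d_{\mathbf{x}}(p)=\min(\sum_{v\in p}f_v(x_v),T)$, and $d_{\mathbf{x}}(u,v)$ is the minimum of $d_{\mathbf{x}}(p)$ over paths $p$ from $u$ to $v$. The cLPI problem asks for an impact vector $\mathbf{x}$ with minimum $\|\mathbf{x}\|$ such that $d_{\mathbf{x}}(s,t)\ge T$ for all $(s,t)\in S$. A simple path is a path visiting no node more than once. $\mathcal{F}$ is the set of all feasible paths: simple paths $p$ connecting some pair in $S$ with $\sum_{v\in p}f_v(0)<T$. $\varepsilon\in(0,1)$ is an accuracy parameter. TB oracle: given a set $\mathcal{P}$ of feasible paths and an impact vector $\mathbf{x}$, it returns a nonnegative vector $\mathbf{s}$ with $d_{\mathbf{x}+\mathbf{s}}(p)\ge T(1-\varepsilon)$ for all $p\in\mathcal{P}$ and $\|\mathbf{s}\|\le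 O(\ln(|\mathcal{P}|\varepsilon^{ -1}))\,\|\mathbf{s}^*\|$, where $\mathbf{s}^*$ is a nonnegative vector of minimum $\|\mathbf{s}^*\|$ such that $d_{\mathbf{x}+\mathbf{s}^*}(p)\ge T$ for all $p\in\mathcal{P}$. Full Set Interdiction algorithm (with a positive integer parameter $k$): Start with $\mathcal{P}=\emptyset$, $\mathbf{x}=\mathbf{0}$. While there is $(s,t)\in S$ with $d_{\mathbf{x}}(s,t)<T(1-\varepsilon)$: for each pair $(s,t)\in S$ with $d_{\mathbf{x}}(s,t)<T(1-\varepsilon)$, let $K$ be the $k$ shortest simple paths from $s$ to $t$ under $\mathbf{x}$, remove from $K$ the paths $p$ with $d_{\mathbf{x}}(p)\ge T(1-\varepsilon)$, and set $\mathcal{P}\leftarrow\mathcal{P}\cup K$ (paths accumulate over all iterations); then reset $\mathbf{x}=\mathbf{0}$, run the TB oracle on $\mathcal{P}$ and $\mathbf{x}=\mathbf{0}$ (with $G,\{f_v\},T,\varepsilon$) to get $\mathbf{s}$, and set $\mathbf{x}=\mathbf{s}$. Return $\mathbf{x}$. The constant hidden in the final $O(\cdot)$ depends only on the constant in the oracle's guarantee. -}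

module Defs where

open import Algebra.Bundles using (CommutativeRing)
import Algebra.Construct.NaturalChoice.Min as Min
import Algebra.Properties.Monoid.Mult as Mult
import Algebra.Properties.Monoid.Sum as Sum
open import Data.Fin.Base using (Fin)
open import Data.List.Base using (List; []; foldr; head; last; length; map)
open import Data.List.Membership.Propositional using (_∈_)
open import Data.List.Relation.Unary.All using (All)
open import Data.List.Relation.Unary.Linked using (Linked)
open import Data.List.Relation.Unary.Unique.Propositional using (Unique)
open import Data.Maybe.Base using (just)
open import Data.Nat.Base as ℕ using (ℕ)
open import Data.Product.Base using (∃; ∃-syntax; _×_; _,_; proj₁; proj₂)
open import Data.Sum.Base using (_⊎_)
open import Data.Vec.Functional using (Vector)
open import Function.Bundles using (_⇔_)
open import Level using (0ℓ)
open import Relation.Binary.Bundles using (TotalOrder)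
open import Relation.Binary.Construct.Closure.ReflexiveTransitive using (Star)
open import Relation.Binary.Core using (Rel)
import Relation.Binary.Construct.NonStrictToStrict as Strict
open import Relation.Binary.PropositionalEquality.Core using (_≡_)
open import Relation.Binary.Structures using (IsDecTotalOrder)
open import Relation.Nullary using (¬_)
open import Relation.Unary using (Pred)

-- Dedekind-complete ordered fields: the real numbers, up to unique isomorphism.
-- As usual for a total inverse, the value 0# ⁻¹ is unspecified.

record Reals : Set₁ where
  infix 4 _≤_
  infix 8 _⁻¹
  field
    commutativeRing : CommutativeRing 0ℓ 0ℓ
  open CommutativeRing commutativeRing public
  field
    _≤_             : Rel Carrier 0ℓ
    isDecTotalOrder : IsDecTotalOrder _≈_ _≤_
    0≉1             : ¬ (0# ≈ 1#)
    _⁻¹             : Carrier → Carrier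
    ⁻¹-inverseʳ     : ∀ {x} → ¬ (x ≈ 0#) → x * x ⁻¹ ≈ 1#
    +-monoʳ-≤       : ∀ z {x y} → x ≤ y → z + x ≤ z + y
    *-nonNegative   : ∀ {x y} → 0# ≤ x → 0# ≤ y → 0# ≤ x * y

  IsUpperBound : Pred Carrier 0ℓ → Carrier → Set
  IsUpperBound A b = ∀ {a} → A a → a ≤ b

  field
    complete : (A : Pred Carrier 0ℓ) → ∃ A → ∃ (IsUpperBound A) →
               ∃[ s ] IsUpperBound A s × (∀ {b} → IsUpperBound A b → s ≤ b)

  open IsDecTotalOrder isDecTotalOrder public
    using (isTotalOrder; _≤?_; _≟_; ≤-respˡ-≈; ≤-respʳ-≈)
    renaming (refl to ≤-refl; reflexive to ≤-reflexive; trans to ≤-trans;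
              antisym to ≤-antisym; total to ≤-total)

  totalOrder : TotalOrder 0ℓ 0ℓ 0ℓ
  totalOrder = record { isTotalOrder = isTotalOrder }

  open Strict _≈_ _≤_ public using (_<_)
  open Min totalOrder public using (_⊓_)
  open Sum +-monoid public using (sum)

  fromℕ : ℕ → Carrier
  fromℕ n = Mult._×_ +-monoid n 1#

  -- These laws determine ln on the positive reals: ln x ≤ x - 1, applied to
  -- x and to x ⁻¹, makes a homomorphism monotone, hence a logarithm, and
  -- forces its base to be e.  Values at x ≤ 0# are unspecified.
  record IsNaturalLog (ln : Carrier → Carrier) : Set where
    field
      ln-cong  : ∀ {x y} → 0# < x → x ≈ y → ln x ≈ ln y
      ln-*     : ∀ {x y} → 0# < x → 0# < y → ln (x * y) ≈ ln x + ln y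
      ln≤x-1   : ∀ {x} → 0# < x → ln x ≤ x - 1#

  ℝ≥0 : Set
  ℝ≥0 = ∃[ x ] 0# ≤ x

  value : ℝ≥0 → Carrier
  value = proj₁

  0≥ : ℝ≥0
  0≥ = 0# , ≤-refl

  infixl 6 _+≥_
  _+≥_ : ℝ≥0 → ℝ≥0 → ℝ≥0
  (x , 0≤x) +≥ (y , 0≤y) =
    x + y ,
    ≤-trans 0≤x (≤-trans (≤-reflexive (sym (+-identityʳ x))) (+-monoʳ-≤ x 0≤y))

module CLPI (ℝ : Reals) where
  open Reals ℝ public

  record Instance : Set where
    field
      n      : ℕ
    V : Set
    V = Fin n
    field
      E      : List (V × V)
      f      : V → ℝ≥0 → ℝ≥0
      f-mono : ∀ v {a b} → value a ≤ value b → value (f v a) ≤ value (f v b)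
      S      : List (V × V)
      T      : Carrier

  module _ (I : Instance) where
    open Instance I

    Impact : Set
    Impact = Vector ℝ≥0 n

    𝟎 : Impact
    𝟎 _ = 0≥

    infixl 6 _⊕_
    _⊕_ : Impact → Impact → Impact
    (x ⊕ s) v = x v +≥ s v

    ‖_‖ : Impact → Carrier
    ‖ x ‖ = sum (λ v → value (x v))

    Path : Set
    Path = List V

    IsPath : V → V → Path → Set
    IsPath u v p = Linked (λ a b → (a , b) ∈ E) p × head p ≡ just u × last p ≡ just v

    IsSimplePath : V → V → Path → Set
    IsSimplePath u v p = IsPath u v p × Unique p

    weight : Impact → Path → Carrier
    weight x p = foldr _+_ 0# (map (λ v → value (f v (x v))) p)

    d : Impact → Path → Carrier
    d x p = weight x p ⊓ T

    -- δ is the minimum of d x p over the paths p from u to v.  Since d x p ≤ T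
    -- for every p, admitting T itself as a value changes the minimum only when
    -- there is no path at all, in which case the distance is the cap T.
    record IsDistance (x : Impact) (u v : V) (δ : Carrier) : Set where
      field
        lower    : ∀ p → IsPath u v p → δ ≤ d x p
        capped   : δ ≤ T
        attained : (∃[ p ] IsPath u v p × δ ≈ d x p) ⊎ δ ≈ T

    Distance≥ : Impact → V → V → Carrier → Set
    Distance≥ x u v a = ∃[ δ ] IsDistance x u v δ × a ≤ δ

    Distance< : Impact → V → V → Carrier → Set
    Distance< x u v a = ∃[ δ ] IsDistance x u v δ × δ < a

    IsSolution : Impact → Set
    IsSolution x = ∀ {s t} → (s , t) ∈ S → Distance≥ x s t T

    IsOptimal : Impact → Set
    IsOptimal x = IsSolution x × (∀ y → IsSolution y → ‖ x ‖ ≤ ‖ y ‖)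

    IsFeasiblePath : Path → Set
    IsFeasiblePath p =
      (∃[ s ] ∃[ t ] (s , t) ∈ S × IsSimplePath s t p) × weight 𝟎 p < T

    -- Finite sets of paths are represented by duplicate-free lists, so that
    -- length is cardinality.
    _Enumerates_ : List Path → Pred Path 0ℓ → Set
    P Enumerates A = Unique P × (∀ p → p ∈ P ⇔ A p)

    Blocks : List Path → Impact → Carrier → Set
    Blocks P x a = All (λ p → a ≤ d x p) P

    IsMinimumBlocker : List Path → Impact → Impact → Set
    IsMinimumBlocker P x s* =
      Blocks P (x ⊕ s*) T × (∀ s → Blocks P (x ⊕ s) T → ‖ s* ‖ ≤ ‖ s ‖)

    module _ (ln : Carrier → Carrier) (ε : Carrier) where

      -- c is the constant of the O(·) in the approximation guarantee.  The f v
      -- need not be continuous, so the oracle also warrants that the minimum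
      -- it is compared with is attained.  For P = [] that minimum is 𝟎, so
      -- the unspecified value of ln 0# plays no role.
      record TBOracle (c : Carrier) : Set where
        field
          run       : List Path → Impact → Impact
          blocks    : ∀ P x → Unique P → All IsFeasiblePath P →
                      Blocks P (x ⊕ run P x) (T * (1# - ε))
          guarantee : ∀ P x → Unique P → All IsFeasiblePath P →
                      ∃[ s* ] IsMinimumBlocker P x s* ×
                        ‖ run P x ‖ ≤ c * ln (fromℕ (length P) * ε ⁻¹) * ‖ s* ‖

    -- Ties may be broken arbitrarily; if there are fewer than k simple paths,
    -- all of them are taken.
    record IsKShortest (k : ℕ) (x : Impact) (s t : V) (K : List Path) : Set where
      field
        unique   : Unique K
        simple   : All (IsSimplePath s t) K
        size     : length K ℕ.≤ k
        full     : length K ℕ.< k → ∀ q → IsSimplePath s t q → q ∈ K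
        shortest : ∀ {p} q → p ∈ K → IsSimplePath s t q → ¬ (q ∈ K) → d x p ≤ d x q

    module FullSetInterdiction
      (k : ℕ) (ε : Carrier) (oracle : List Path → Impact → Impact) where

      Violated : Impact → V → V → Set
      Violated x s t = (s , t) ∈ S × Distance< x s t (T * (1# - ε))

      State : Set
      State = List Path × Impact

      data _⟶_ : State → State → Set where
        iterate : ∀ {P x P′}
          → (∃[ s ] ∃[ t ] Violated x s t)
          → (K : V → V → List Path)
          → (∀ {s t} → Violated x s t → IsKShortest k x s t (K s t))
          → P′ Enumerates (λ p → p ∈ P ⊎
              (∃[ s ] ∃[ t ] Violated x s t × p ∈ K s t × ¬ (T * (1# - ε) ≤ d x p)))
          → (P , x) ⟶ (P′ , oracle P′ 𝟎)

      IsOutput : Impact → Set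
      IsOutput x =
        ∃[ P ] Star _⟶_ ([] , 𝟎) (P , x) × ¬ (∃[ s ] ∃[ t ] Violated x s t)

{-# OPTIONS --safe #-}
module Submission where

-- Every path that the algorithm collects is feasible, so the last oracle call
-- sees a set P of at most |𝓕| feasible paths.  An optimal solution x* blocks
-- every feasible path, hence ‖s*‖ ≤ ‖x*‖ for a minimum blocker s* of P, and
-- the guarantee of the oracle gives the bound with C = c.  The degenerate case
-- 𝓕 = ∅, where ln(|𝓕|/ε) has no meaning, is harmless: then 𝟎 is a solution
-- (every path contains a simple one that is no heavier), whence ‖x*‖ = 0.

open import Defs
open import Data.Fin.Base using (Fin; zero; suc)
import Data.Fin.Properties as Finₚ
open import Data.List.Base using (List; []; _∷_; length; lookup)
open import Data.List.Membership.Propositional using (_∈_)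
open import Data.List.Membership.Propositional.Properties using (∈-lookup)
open import Data.List.Relation.Unary.All as All using (All; []; _∷_)
open import Data.List.Relation.Unary.All.Properties using (¬Any⇒All¬)
import Data.List.Relation.Unary.AllPairs as AllPairs
open import Data.List.Relation.Unary.Any using (here; there)
import Data.List.Membership.DecPropositional as DecMembership
open import Data.List.Membership.Setoid.Properties using (index-injective)
open import Data.List.Relation.Unary.Linked as Linked using (_∷_)
open import Data.List.Relation.Unary.Unique.Propositional using (Unique; []; _∷_)
open import Data.Nat.Base as ℕ using (ℕ; NonZero)
open import Data.Product.Base using (∃-syntax; _×_; _,_; proj₁; proj₂)
open import Data.Sum.Base using (inj₁; inj₂)
open import Function.Base using (_∘_)
open import Function.Bundles using (Equivalence)
open import Relation.Binary.Bundles using (TotalOrder)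
open import Relation.Binary.Construct.Closure.ReflexiveTransitive using (Star; ε; _◅_)
import Relation.Binary.Construct.NonStrictToStrict as Strict
open import Relation.Binary.PropositionalEquality as ≡ using (_≡_)
import Relation.Binary.Reasoning.PartialOrder as PartialOrderReasoning
open import Relation.Nullary using (¬_; yes; no; contradiction)

-- Counting in duplicate-free lists.

module _ {a} {A : Set a} where

  lookup-injective : ∀ {xs : List A} → Unique xs →
                     ∀ {i j} → lookup xs i ≡ lookup xs j → i ≡ j
  lookup-injective (x∉ ∷ u) {zero}  {zero}  eq = ≡.refl
  lookup-injective (x∉ ∷ u) {zero}  {suc j} eq =
    contradiction eq (All.lookup x∉ (∈-lookup j))
  lookup-injective (x∉ ∷ u) {suc i} {zero}  eq =
    contradiction (≡.sym eq) (All.lookup x∉ (∈-lookup i))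
  lookup-injective (x∉ ∷ u) {suc i} {suc j} eq = ≡.cong suc (lookup-injective u eq)

  -- Sending each position of `xs` to a position in `ys` that holds the same entry is injective:
  -- equal targets hold equal entries, and `xs` has no repetition.
  unique∧⊆⇒length≤ : ∀ {xs ys : List A} → Unique xs →
                     (∀ {x} → x ∈ xs → x ∈ ys) → length xs ℕ.≤ length ys
  unique∧⊆⇒length≤ {xs} {ys} u xs⊆ys = Finₚ.injective⇒≤ λ {i} {j} eq →
    lookup-injective u
      (index-injective (≡.setoid A) (member i) (member j) eq)
    where
    member : ∀ i → lookup xs i ∈ ys
    member i = xs⊆ys (∈-lookup i)

-- Ordered-field arithmetic.

module OrderedField (ℝ : Reals) where
  open Reals ℝ hiding (zero)
  open import Algebra.Construct.NaturalChoice.Min totalOrder public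
    using (⊓-glb; ⊓-monoˡ-≤)
  open import Algebra.Properties.Ring ring using (-‿distribʳ-*)
  open PartialOrderReasoning (TotalOrder.poset totalOrder)

  <⇒≱ : ∀ {x y} → x < y → ¬ y ≤ x
  <⇒≱ = Strict.<⇒≱ _≈_ _≤_ ≤-antisym

  ≰⇒> : ∀ {x y} → ¬ x ≤ y → y < x
  ≰⇒> = Strict.≰⇒> _≈_ _≤_ sym ≤-reflexive ≤-total

  ≰⇒≥ : ∀ {x y} → ¬ x ≤ y → y ≤ x
  ≰⇒≥ = proj₁ ∘ ≰⇒>

  <-≤-trans : ∀ {x y z} → x < y → y ≤ z → x < z
  <-≤-trans = Strict.<-≤-trans _≈_ _≤_ sym ≤-trans ≤-antisym ≤-respʳ-≈

  +-monoˡ-≤ : ∀ z {x y} → x ≤ y → x + z ≤ y + z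
  +-monoˡ-≤ z {x} {y} x≤y = begin
    x + z ≈⟨ +-comm x z ⟩
    z + x ≤⟨ +-monoʳ-≤ z x≤y ⟩
    z + y ≈⟨ +-comm z y ⟩
    y + z ∎

  +-mono-≤ : ∀ {x y u v} → x ≤ y → u ≤ v → x + u ≤ y + v
  +-mono-≤ x≤y u≤v = ≤-trans (+-monoˡ-≤ _ x≤y) (+-monoʳ-≤ _ u≤v)

  x≤y⇒0≤y-x : ∀ {x y} → x ≤ y → 0# ≤ y - x
  x≤y⇒0≤y-x {x} x≤y = ≤-respˡ-≈ (-‿inverseʳ x) (+-monoˡ-≤ (- x) x≤y)

  0≤y-x⇒x≤y : ∀ {x y} → 0# ≤ y - x → x ≤ y
  0≤y-x⇒x≤y {x} {y} 0≤y-x = begin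
    x             ≈⟨ +-identityˡ x ⟨
    0# + x        ≤⟨ +-monoˡ-≤ x 0≤y-x ⟩
    y - x + x     ≈⟨ +-assoc y (- x) x ⟩
    y + (- x + x) ≈⟨ +-congˡ (-‿inverseˡ x) ⟩
    y + 0#        ≈⟨ +-identityʳ y ⟩
    y             ∎

  *-monoʳ-≤ : ∀ {x y z} → 0# ≤ z → x ≤ y → z * x ≤ z * y
  *-monoʳ-≤ {x} {y} {z} 0≤z x≤y = 0≤y-x⇒x≤y (begin
    0#              ≤⟨ *-nonNegative 0≤z (x≤y⇒0≤y-x x≤y) ⟩
    z * (y - x)     ≈⟨ distribˡ z y (- x) ⟩
    z * y + z * - x ≈⟨ +-congˡ (-‿distribʳ-* z x) ⟨
    z * y - z * x   ∎)

  *-monoˡ-≤ : ∀ {x y z} → 0# ≤ z → x ≤ y → x * z ≤ y * z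
  *-monoˡ-≤ {x} {y} {z} 0≤z x≤y = begin
    x * z ≈⟨ *-comm x z ⟩
    z * x ≤⟨ *-monoʳ-≤ 0≤z x≤y ⟩
    z * y ≈⟨ *-comm z y ⟩
    y * z ∎

  x≤0⇒0≤-x : ∀ {x} → x ≤ 0# → 0# ≤ - x
  x≤0⇒0≤-x {x} x≤0 = ≤-respʳ-≈ (+-identityˡ (- x)) (x≤y⇒0≤y-x x≤0)

  -- Otherwise -1 would be nonnegative, and so would its square, which is 1.
  0≤1 : 0# ≤ 1#
  0≤1 with ≤-total 0# 1#
  ... | inj₁ 0≤1 = 0≤1
  ... | inj₂ 1≤0 = ≤-respʳ-≈ -1*-1≈1 (*-nonNegative 0≤-1 0≤-1)
    where
    open import Algebra.Properties.Ring ring using (-1*x≈-x; -‿involutive)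
    0≤-1 = x≤0⇒0≤-x 1≤0
    -1*-1≈1 = trans (-1*x≈-x (- 1#)) (-‿involutive 1#)

  0<1 : 0# < 1#
  0<1 = 0≤1 , 0≉1

  x*[1-y]≤x : ∀ {x y} → 0# ≤ x → 0# ≤ y → x * (1# - y) ≤ x
  x*[1-y]≤x {x} {y} 0≤x 0≤y = ≤-respʳ-≈ (*-identityʳ x) (*-monoʳ-≤ 0≤x (begin
    1# - y         ≈⟨ +-identityʳ (1# - y) ⟨
    1# - y + 0#    ≤⟨ +-monoʳ-≤ (1# - y) 0≤y ⟩
    1# - y + y     ≈⟨ +-assoc 1# (- y) y ⟩
    1# + (- y + y) ≈⟨ +-congˡ (-‿inverseˡ y) ⟩
    1# + 0#        ≈⟨ +-identityʳ 1# ⟩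
    1#             ∎))

  0≤x⁻¹ : ∀ {x} → 0# < x → 0# ≤ x ⁻¹
  0≤x⁻¹ {x} 0<x@(0≤x , 0≉x) with ≤-total 0# (x ⁻¹)
  ... | inj₁ 0≤x⁻¹ = 0≤x⁻¹
  ... | inj₂ x⁻¹≤0 = contradiction (begin
    1#       ≈⟨ ⁻¹-inverseʳ (0≉x ∘ sym) ⟨
    x * x ⁻¹ ≤⟨ *-monoʳ-≤ 0≤x x⁻¹≤0 ⟩
    x * 0#   ≈⟨ zeroʳ x ⟩
    0#       ∎) (<⇒≱ 0<1)

  1≤x⁻¹ : ∀ {x} → 0# < x → x ≤ 1# → 1# ≤ x ⁻¹
  1≤x⁻¹ {x} 0<x@(_ , 0≉x) x≤1 = begin
    1#         ≈⟨ ⁻¹-inverseʳ (0≉x ∘ sym) ⟨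
    x * x ⁻¹   ≤⟨ *-monoˡ-≤ (0≤x⁻¹ 0<x) x≤1 ⟩
    1# * x ⁻¹  ≈⟨ *-identityˡ (x ⁻¹) ⟩
    x ⁻¹       ∎

  0≤fromℕ : ∀ n → 0# ≤ fromℕ n
  0≤fromℕ ℕ.zero    = ≤-refl
  0≤fromℕ (ℕ.suc n) = ≤-respˡ-≈ (+-identityˡ 0#) (+-mono-≤ 0≤1 (0≤fromℕ n))

  fromℕ-mono-≤ : ∀ {m n} → m ℕ.≤ n → fromℕ m ≤ fromℕ n
  fromℕ-mono-≤ {n = n} ℕ.z≤n = 0≤fromℕ n
  fromℕ-mono-≤ (ℕ.s≤s m≤n)   = +-monoʳ-≤ 1# (fromℕ-mono-≤ m≤n)

  -- Keeps the argument of the logarithm in the range where `ln` is nonnegative, as soon as the set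
  -- of paths is nonempty.
  1≤n⇒1≤fromℕ*x⁻¹ : ∀ {n x} → 1 ℕ.≤ n → 0# < x → x ≤ 1# → 1# ≤ fromℕ n * x ⁻¹
  1≤n⇒1≤fromℕ*x⁻¹ {n} {x} 1≤n 0<x x≤1 = begin
    1#              ≤⟨ 1≤x⁻¹ 0<x x≤1 ⟩
    x ⁻¹            ≈⟨ *-identityˡ (x ⁻¹) ⟨
    1# * x ⁻¹       ≈⟨ *-congʳ (+-identityʳ 1#) ⟨
    fromℕ 1 * x ⁻¹  ≤⟨ *-monoˡ-≤ (0≤x⁻¹ 0<x) (fromℕ-mono-≤ 1≤n) ⟩
    fromℕ n * x ⁻¹  ∎

  sum-zero : ∀ n → sum {n} (λ _ → 0#) ≈ 0#
  sum-zero ℕ.zero    = refl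
  sum-zero (ℕ.suc n) = trans (+-identityˡ _) (sum-zero n)

  sum-nonNegative : ∀ {n} {x : Fin n → Carrier} → (∀ i → 0# ≤ x i) → 0# ≤ sum x
  sum-nonNegative {ℕ.zero}  0≤x = ≤-refl
  sum-nonNegative {ℕ.suc n} 0≤x =
    ≤-respˡ-≈ (+-identityˡ 0#) (+-mono-≤ (0≤x zero) (sum-nonNegative (0≤x ∘ suc)))

  -- Sign and monotonicity of the logarithm.

  module NaturalLog {ln : Carrier → Carrier} (isLn : IsNaturalLog ln) where
    open IsNaturalLog isLn

    ln-nonPositive : ∀ {x} → 0# < x → x ≤ 1# → ln x ≤ 0#
    ln-nonPositive {x} 0<x x≤1 = begin
      ln x    ≤⟨ ln≤x-1 0<x ⟩
      x - 1#  ≤⟨ +-monoˡ-≤ (- 1#) x≤1 ⟩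
      1# - 1# ≈⟨ -‿inverseʳ 1# ⟩
      0#      ∎

    -- Factor `x` as `(x * y ⁻¹) * y`: the first factor is at most 1, so its logarithm is
    -- nonpositive.
    ln-mono-≤ : ∀ {x y} → 0# < x → x ≤ y → ln x ≤ ln y
    ln-mono-≤ {x} {y} 0<x@(0≤x , 0≉x) x≤y = begin
      ln x                  ≈⟨ ln-cong 0<x (sym x*y⁻¹*y≈x) ⟩
      ln (x * y ⁻¹ * y)     ≈⟨ ln-* 0<x*y⁻¹ 0<y ⟩
      ln (x * y ⁻¹) + ln y  ≤⟨ +-monoˡ-≤ (ln y) (ln-nonPositive 0<x*y⁻¹ x*y⁻¹≤1) ⟩
      0# + ln y             ≈⟨ +-identityˡ (ln y) ⟩
      ln y                  ∎
      where
      0<y : 0# < y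
      0<y = <-≤-trans 0<x x≤y
      y*y⁻¹≈1 : y * y ⁻¹ ≈ 1#
      y*y⁻¹≈1 = ⁻¹-inverseʳ (proj₂ 0<y ∘ sym)
      x*y⁻¹*y≈x : x * y ⁻¹ * y ≈ x
      x*y⁻¹*y≈x = trans (*-assoc x (y ⁻¹) y)
        (trans (*-congˡ (trans (*-comm (y ⁻¹) y) y*y⁻¹≈1)) (*-identityʳ x))
      0<x*y⁻¹ : 0# < x * y ⁻¹
      0<x*y⁻¹ = *-nonNegative 0≤x (0≤x⁻¹ 0<y) , λ 0≈x*y⁻¹ →
        0≉x (trans (sym (zeroˡ y)) (trans (*-congʳ 0≈x*y⁻¹) x*y⁻¹*y≈x))
      x*y⁻¹≤1 : x * y ⁻¹ ≤ 1#
      x*y⁻¹≤1 = ≤-respʳ-≈ y*y⁻¹≈1 (*-monoˡ-≤ (0≤x⁻¹ 0<y) x≤y)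

    ln-nonNegative : ∀ {x} → 1# ≤ x → 0# ≤ ln x
    ln-nonNegative {x} 1≤x = ≤-trans (≤-reflexive (sym ln1≈0)) (ln-mono-≤ 0<1 1≤x)
      where
      open import Algebra.Properties.Ring ring using (x+x≈x⇒x≈0)
      ln1≈0 : ln 1# ≈ 0#
      -- Since 1 = 1 * 1, the homomorphism law makes `ln 1#` its own double.
      ln1≈0 = x+x≈x⇒x≈0 (ln 1#)
        (trans (sym (ln-* 0<1 0<1))
               (ln-cong (*-nonNegative 0≤1 0≤1 , λ 0≈1*1 → 0≉1 (trans 0≈1*1 (*-identityˡ 1#)))
                        (*-identityˡ 1#)))

-- Path weights, loop removal and distances.

module Paths (ℝ : Reals) (I : CLPI.Instance ℝ) where
  open CLPI ℝ
  open OrderedField ℝ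
  open Instance I
  open PartialOrderReasoning (TotalOrder.poset totalOrder)
  open DecMembership {A = V} Finₚ._≟_ using (_∈?_)

  ‖𝟎‖≈0 : ‖_‖ I (𝟎 I) ≈ 0#
  ‖𝟎‖≈0 = sum-zero n

  0≤‖_‖ : ∀ x → 0# ≤ ‖_‖ I x
  0≤‖ x ‖ = sum-nonNegative (proj₂ ∘ x)

  weight-mono-≤ : ∀ {x y : Impact I} → (∀ v → value (x v) ≤ value (y v)) →
                  ∀ p → weight I x p ≤ weight I y p
  weight-mono-≤ x≤y []      = ≤-refl
  weight-mono-≤ x≤y (v ∷ p) = +-mono-≤ (f-mono v (x≤y v)) (weight-mono-≤ x≤y p)

  0≤weight : ∀ x p → 0# ≤ weight I x p
  0≤weight x []      = ≤-refl
  0≤weight x (v ∷ p) =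
    ≤-respˡ-≈ (+-identityˡ 0#) (+-mono-≤ (proj₂ (f v (x v))) (0≤weight x p))

  weight-∷-≤ : ∀ x v p → weight I x p ≤ weight I x (v ∷ p)
  weight-∷-≤ x v p = ≤-respˡ-≈ (+-identityˡ _) (+-monoˡ-≤ _ (proj₂ (f v (x v))))

  LighterSimplePath : Impact I → V → V → Path I → Set
  LighterSimplePath x u v p =
    ∃[ q ] IsSimplePath I u v q × weight I x q ≤ weight I x p

  -- Every `f v` is nonnegative, so cutting off the nodes before `a` adds no weight; the suffix
  -- keeps its edges, its last node and its freedom from repetition.
  suffixFrom : ∀ x {a u v q} → a ∈ q → IsSimplePath I u v q → LighterSimplePath x a v q
  suffixFrom x (here ≡.refl) ((linked , _ , last≡) , unique) =
    _ , ((linked , ≡.refl , last≡) , unique) , ≤-refl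
  suffixFrom x {q = b ∷ c ∷ q} (there a∈q) ((linked , _ , last≡) , unique) =
    let r , simple , r≤q = suffixFrom x a∈q
          ((Linked.tail linked , ≡.refl , last≡) , AllPairs.tail unique)
    in r , simple , ≤-trans r≤q (weight-∷-≤ x b (c ∷ q))

  -- Loop removal by recursion on the tail: if the first node already lies on the simplified tail,
  -- jump to that occurrence; otherwise prepend it.
  simplify : ∀ x {u v} p → IsPath I u v p → LighterSimplePath x u v p
  simplify x (a ∷ []) (linked , ≡.refl , last≡) =
    _ , ((linked , ≡.refl , last≡) , [] ∷ []) , ≤-refl
  simplify x (a ∷ b ∷ p) (ab∈E ∷ linked , ≡.refl , last≡)
    with simplify x (b ∷ p) (linked , ≡.refl , last≡)
  -- Exposing the head of `q` identifies it with `b`, so that the edge from `a` to `b` still fits in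
  -- front.
  ... | q@(_ ∷ _) , simple@((qLinked , ≡.refl , qLast) , unique) , q≤p with a ∈? q
  ...   | yes a∈q =
          let r , rSimple , r≤q = suffixFrom x a∈q simple
          in r , rSimple , ≤-trans r≤q (≤-trans q≤p (weight-∷-≤ x a (b ∷ p)))
  ...   | no  a∉q =
          a ∷ q , ((ab∈E ∷ qLinked , ≡.refl , qLast) , ¬Any⇒All¬ q a∉q ∷ unique) ,
          +-monoʳ-≤ _ q≤p

  cap-isDistance : ∀ {x u v} → (∀ p → IsPath I u v p → T ≤ weight I x p) →
                   IsDistance I x u v T
  cap-isDistance T≤weight = record
    { lower    = λ p isPath → ⊓-glb (T≤weight p isPath) ≤-refl
    ; capped   = ≤-refl
    ; attained = inj₂ refl
    }

  solution-d : ∀ {x} → IsSolution I x → ∀ {s t p} → (s , t) ∈ S → IsPath I s t p →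
               T ≤ d I x p
  solution-d solution st∈S isPath =
    let δ , isDistance , T≤δ = solution st∈S
    in ≤-trans T≤δ (IsDistance.lower isDistance _ isPath)

  solution-blocks : ∀ {x P} → IsSolution I x → All (IsFeasiblePath I) P →
                    Blocks I P (_⊕_ I (𝟎 I) x) T
  solution-blocks {x} solution = All.map λ {p} ((_ , _ , st∈S , (isPath , _)) , _) →
    ≤-trans (solution-d solution st∈S isPath)
            -- The entries of `𝟎 ⊕ x` agree with those of `x` only up to `≈`; monotonicity of each
            -- `f v` carries the bound across.
            (⊓-monoˡ-≤ T (weight-mono-≤ (λ v → ≤-reflexive (sym (+-identityˡ _))) p))

  𝟎-solution : (∀ p → ¬ IsFeasiblePath I p) → IsSolution I (𝟎 I)
  𝟎-solution infeasible {s} {t} st∈S = T , cap-isDistance T≤weight , ≤-refl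
    where
    T≤weight : ∀ p → IsPath I s t p → T ≤ weight I (𝟎 I) p
    T≤weight p isPath with simplify (𝟎 I) p isPath
    ... | q , simple , q≤p with T ≤? weight I (𝟎 I) q
    ...   | yes T≤q = ≤-trans T≤q q≤p
    -- A simple path lighter than `T` under `𝟎` is exactly a feasible one.
    ...   | no  T≰q = contradiction ((s , t , st∈S , simple) , ≰⇒> T≰q) (infeasible q)

  -- Impacts only increase weights, so a path of weight at least `T` under `𝟎` would have capped
  -- length `T` under `x` as well.
  d<⇒feasible : ∀ {x s t p} → (s , t) ∈ S → IsSimplePath I s t p → d I x p < T →
                IsFeasiblePath I p
  d<⇒feasible {x} {p = p} st∈S simple dp<T = (_ , _ , st∈S , simple) ,
    ≰⇒> λ T≤w → <⇒≱ dp<T (⊓-glb (≤-trans T≤w (weight-mono-≤ (proj₂ ∘ x) p)) ≤-refl)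

-- The norm bound for a single oracle call.

module Analysis (ℝ : Reals) where
  open CLPI ℝ
  open OrderedField ℝ

  module Run
    {ln : Carrier → Carrier} (isLn : IsNaturalLog ln)
    {c : Carrier} (0<c : 0# < c) (I : Instance) {ϵ : Carrier} (0<ϵ : 0# < ϵ) (ϵ<1 : ϵ < 1#)
    (k : ℕ) (oracle : TBOracle I ln ϵ c)
    (𝓕 : List (Path I)) (enumerates : _Enumerates_ I 𝓕 (IsFeasiblePath I))
    {x* : Impact I} (optimal : IsOptimal I x*)
    where

    open NaturalLog isLn
    open Paths ℝ I
    open Instance I
    open TBOracle oracle
    open FullSetInterdiction I k ϵ run
    open PartialOrderReasoning (TotalOrder.poset totalOrder)

    Λ : List (Path I) → Carrier
    Λ P = ln (fromℕ (length P) * ϵ ⁻¹)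

    bound : Carrier
    bound = ‖_‖ I x* * (c * Λ 𝓕)

    Λ-nonNegative : ∀ P → 1 ℕ.≤ length P → 0# ≤ Λ P
    Λ-nonNegative P 1≤P = ln-nonNegative (1≤n⇒1≤fromℕ*x⁻¹ 1≤P 0<ϵ (proj₁ ϵ<1))

    Λ-mono-≤ : ∀ P Q → 1 ℕ.≤ length P → length P ℕ.≤ length Q → Λ P ≤ Λ Q
    Λ-mono-≤ P Q 1≤P P≤Q =
      ln-mono-≤ (<-≤-trans 0<1 (1≤n⇒1≤fromℕ*x⁻¹ 1≤P 0<ϵ (proj₁ ϵ<1)))
                (*-monoˡ-≤ (0≤x⁻¹ 0<ϵ) (fromℕ-mono-≤ P≤Q))

    feasible⇒∈𝓕 : ∀ {p} → IsFeasiblePath I p → p ∈ 𝓕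
    feasible⇒∈𝓕 {p} = Equivalence.from (proj₂ enumerates p)

    -- The list is a variable so that emptiness can be decided by matching. For `[]` nothing is
    -- known about `Λ []`, so the product must vanish through the factor `‖ x* ‖`.
    bound-nonNegative : ∀ Q → (∀ {p} → IsFeasiblePath I p → p ∈ Q) →
                        0# ≤ ‖_‖ I x* * (c * Λ Q)
    bound-nonNegative Q@(_ ∷ _) _ =
      *-nonNegative 0≤‖ x* ‖ (*-nonNegative (proj₁ 0<c) (Λ-nonNegative Q (ℕ.s≤s ℕ.z≤n)))
    bound-nonNegative [] feasible⇒∈[] = ≤-reflexive (sym (trans (*-congʳ ‖x*‖≈0) (zeroˡ _)))
      where
      𝟎-isSolution : IsSolution I (𝟎 I)
      𝟎-isSolution = 𝟎-solution λ p feasible → contradiction (feasible⇒∈[] feasible) λ ()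
      ‖x*‖≈0 : ‖_‖ I x* ≈ 0#
      ‖x*‖≈0 = ≤-antisym (≤-respʳ-≈ ‖𝟎‖≈0 (proj₂ optimal _ 𝟎-isSolution)) 0≤‖ x* ‖

    0≤bound : 0# ≤ bound
    0≤bound = bound-nonNegative 𝓕 feasible⇒∈𝓕

    ‖run‖≤bound : ∀ P → Unique P → All (IsFeasiblePath I) P → ‖_‖ I (run P (𝟎 I)) ≤ bound
    ‖run‖≤bound P unique feasible with guarantee P (𝟎 I) unique feasible
    -- Here `Λ []` is unspecified, but `𝟎` blocks the empty set vacuously, so the minimum blocker
    -- has norm zero and annihilates it.
    ‖run‖≤bound [] _ _ | s* , (_ , minimum) , run≤ = begin
      ‖_‖ I (run [] (𝟎 I))   ≤⟨ run≤ ⟩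
      c * Λ [] * ‖_‖ I s*    ≈⟨ *-congˡ ‖s*‖≈0 ⟩
      c * Λ [] * 0#          ≈⟨ zeroʳ _ ⟩
      0#                     ≤⟨ 0≤bound ⟩
      bound                  ∎
      where
      ‖s*‖≈0 : ‖_‖ I s* ≈ 0#
      ‖s*‖≈0 = ≤-antisym (≤-respʳ-≈ ‖𝟎‖≈0 (minimum (𝟎 I) [])) 0≤‖ s* ‖
    ‖run‖≤bound P@(_ ∷ _) unique feasible | s* , (_ , minimum) , run≤ = begin
      -- The coefficient `c * Λ P` must be nonnegative before `s*` may be replaced by its competitor
      -- `x*`; this is where nonemptiness of `P` enters.
      ‖_‖ I (run P (𝟎 I))    ≤⟨ run≤ ⟩
      c * Λ P * ‖_‖ I s*     ≤⟨ *-monoʳ-≤ (*-nonNegative (proj₁ 0<c) (Λ-nonNegative P 1≤P))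
                                          (minimum x* (solution-blocks (proj₁ optimal) feasible)) ⟩
      c * Λ P * ‖_‖ I x*     ≤⟨ *-monoˡ-≤ 0≤‖ x* ‖ (*-monoʳ-≤ (proj₁ 0<c) (Λ-mono-≤ P 𝓕 1≤P P≤𝓕)) ⟩
      c * Λ 𝓕 * ‖_‖ I x*     ≈⟨ *-comm _ _ ⟩
      bound                  ∎
      where
      1≤P : 1 ℕ.≤ length P
      1≤P = ℕ.s≤s ℕ.z≤n
      P≤𝓕 : length P ℕ.≤ length 𝓕
      P≤𝓕 = unique∧⊆⇒length≤ unique (feasible⇒∈𝓕 ∘ All.lookup feasible)

    -- The invariant along a run and the bound on the output.

    Invariant : State → Set
    Invariant (P , x) = Unique P × All (IsFeasiblePath I) P × ‖_‖ I x ≤ bound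

    initial : Invariant ([] , 𝟎 I)
    initial = [] , [] , ≤-trans (≤-reflexive ‖𝟎‖≈0) 0≤bound

    -- Nothing is assumed about the sign of `T`. If it is negative the inequality fails, yet a run
    -- with no target pairs still terminates; hence the guard by membership in `S`.
    ThresholdBelowCap : Set
    ThresholdBelowCap = ∀ {s t} → (s , t) ∈ S → T * (1# - ϵ) ≤ T

    -- Feasibility is inherited by the accumulated paths and checked for the new ones; the norm
    -- bound is obtained afresh, because each oracle call starts from `𝟎`.
    preserved : ThresholdBelowCap → ∀ {σ τ} → Invariant σ → σ ⟶ τ → Invariant τ
    preserved belowCap {P , x} (_ , feasible , _) (iterate {P′ = P′} _ K shortest (unique′ , ∈P′⇔)) =
      unique′ , feasible′ , ‖run‖≤bound P′ unique′ feasible′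
      where
      feasible′ : All (IsFeasiblePath I) P′
      feasible′ = All.tabulate λ {p} p∈P′ → case-∈ p (Equivalence.to (∈P′⇔ p) p∈P′)
        where
        case-∈ : ∀ p → _ → IsFeasiblePath I p
        case-∈ p (inj₁ p∈P) = All.lookup feasible p∈P
        -- A path that survives the filter has capped length below `T * (1# - ϵ)`, hence below the
        -- cap `T`.
        case-∈ p (inj₂ (s , t , violated@(st∈S , _) , p∈K , d≱)) =
          d<⇒feasible {x} st∈S (All.lookup (IsKShortest.simple (shortest violated)) p∈K)
            (<-≤-trans (≰⇒> d≱) (belowCap st∈S))

    reachable : ThresholdBelowCap → ∀ {σ τ} → Invariant σ → Star _⟶_ σ τ → Invariant τ
    reachable belowCap inv ε              = inv
    reachable belowCap inv (step ◅ steps) =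
      reachable belowCap (preserved belowCap inv step) steps

    -- If T < 0, then T (1 - ϵ) exceeds the cap T, so a target pair stays violated
    -- for ever and the algorithm has no output.
    terminated⇒belowCap : ∀ {x} → ¬ (∃[ s ] ∃[ t ] Violated x s t) → ThresholdBelowCap
    terminated⇒belowCap {x} terminated {s} {t} st∈S with T * (1# - ϵ) ≤? T
    ... | yes T[1-ϵ]≤T = T[1-ϵ]≤T
    ... | no  T[1-ϵ]≰T =
      contradiction (s , t , st∈S , T , cap-isDistance T≤weight , ≰⇒> T[1-ϵ]≰T) terminated
      where
      T≤0 : T ≤ 0#
      T≤0 = ≰⇒≥ λ 0≤T → T[1-ϵ]≰T (x*[1-y]≤x 0≤T (proj₁ 0<ϵ))
      T≤weight : ∀ p → IsPath I s t p → T ≤ weight I x p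
      T≤weight p _ = ≤-trans T≤0 (0≤weight x p)

    -- `ThresholdBelowCap` depends on no state, so termination at the last state supplies it for all
    -- the earlier steps.
    output≤bound : ∀ {x} → IsOutput x → ‖_‖ I x ≤ bound
    output≤bound (_ , steps , terminated) =
      proj₂ (proj₂ (reachable (terminated⇒belowCap terminated) initial steps))

theorem5 : (ℝ : Reals) → let open CLPI ℝ in
    (ln : Carrier → Carrier) → IsNaturalLog ln →
    (c : Carrier) → 0# < c →
    ∃[ C ] 0# < C ×
    ((I : Instance) (ε : Carrier) → 0# < ε → ε < 1# →
    (k : ℕ) .{{_ : NonZero k}} →
    (oracle : TBOracle I ln ε c) →
    (𝓕 : List (Path I)) → _Enumerates_ I 𝓕 (IsFeasiblePath I) →
    (x x* : Impact I) →
    FullSetInterdiction.IsOutput I k ε (TBOracle.run oracle) x →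
    IsOptimal I x* →
    ‖_‖ I x ≤ ‖_‖ I x* * (C * ln (fromℕ (length 𝓕) * ε ⁻¹)))
-- The constant is fixed before the instance, the accuracy and `k`, so it is uniform in them.
theorem5 ℝ ln isLn c 0<c = c , 0<c , λ I ε 0<ε ε<1 k oracle 𝓕 enumerates x x* output optimal →
  Analysis.Run.output≤bound ℝ isLn 0<c I 0<ε ε<1 k oracle 𝓕 enumerates optimal output
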